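{- Let $\mathsf{X}\subseteq\{\mathsf{d},\mathsf{t},\mathsf{4}\}$ and $\mathsf{Y}\subseteq\{\mathsf{d},\mathsf{t},\mathsf{b},\mathsf{4},\mathsf{5}\}$. (i) If $n\in\{0,1,2\}$ and $\Gamma_1,\ldots,\Gamma_n\,/\,\Gamma$ (premises $\Gamma_1,\dots,\Gamma_n$, conclusion $\Gamma$) is an instance of a rule in $\mathsf{NCK}+\mathsf{w}+\mathsf{cut}+\mathsf{X}^{\bullet\circ}+\mathsf{Y}^{[\,]}$, then the formula $\mathit{fm}(\Gamma_1)\wedge\cdots\wedge\mathit{fm}(\Gamma_n)\supset\mathit{fm}(\Gamma)$ is provable in $\mathsf{HCK}+\mathsf{X}+\mathsf{Y}$. (ii) Whenever a sequent $\Gamma$ is provable in $\mathsf{NCK}+\mathsf{w}+\mathsf{cut}+\mathsf{X}^{\bullet\circ}+\mathsf{Y}^{[\,]}$, then $\mathit{fm}(\Gamma)$ is provable in $\mathsf{HCK}+\mathsf{X}+\mathsf{Y}$.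
   Context: **Formulas.** $A::=a\mid\bot\mid A\wedge A\mid A\vee A\mid A\supset A\mid\Box A\mid\Diamond A$, with $a$ ranging over propositional variables; $\top:=\bot\supset\bot$. **Nested sequents.** Formulas are tagged with a polarity: input ($A^\bullet$) or output ($A^\circ$). LHS sequents: $\Phi::=\emptyset\mid A^\bullet\mid[\Phi]\mid\Phi,\Phi$. RHS sequents: $\Psi::=A^\circ\mid[\Phi,\Psi]$. A full sequent is a structure $\Phi,\Psi$ (so it contains exactly one output formula). The comma is associative and commutative with unit $\emptyset$. A superscript $\bullet$ (resp. $\circ$) on a capital Greek letter means that it denotes an LHS (resp. RHS) sequent. **Corresponding formula.** $\mathit{fm}(A^\bullet)=\mathit{fm}(A^\circ)=A$, $\mathit{fm}([\Phi])=\Diamond\mathit{fm}(\Phi)$, $\mathit{fm}([\Phi,\Psi])=\Box(\mathit{fm}(\Phi,\Psi))$, $\mathit{fm}(\emptyset)=\top$, $\mathit{fm}(\Phi_1,\Phi_2)=\mathit{fm}(\Phi_1)\wedge\mathit{fm}(\Phi_2)$, $\mathit{fm}(\Phi,\Psi)=\mathit{fm}(\Phi)\supset\mathit{fm}(\Psi)$. **Contexts.** A context $\Gamma\{\ \}$ is a sequent with a hole in place of a subsequent; $\Gamma\{\Delta\}$ is the result of filling the hole with $\Delta$ and $\Gamma\{\emptyset\}$ the result of deleting it. An output context is one giving a full sequent when filled with an RHS sequent; it has the shape $\Gamma_1^\bullet,[\Gamma_2^\bullet,[\ldots,[\Gamma_n^\bullet,\{\ \}]\ldots]]$. An input context is one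 giving a full sequent when filled with an LHS sequent; it has the shape $\Gamma'\{\Lambda\{\ \},\Pi^\circ\}$ with $\Gamma'\{\ \},\Lambda\{\ \}$ output contexts. Output pruning: for an input context $\Gamma\{\ \}=\Gamma'\{\Lambda\{\ \},\Pi^\circ\}$ put $\Gamma^{\Downarrow}\{\ \}=\Gamma'\{\Lambda\{\ \}\}$; for an output context $\Gamma^{\Downarrow}\{\ \}=\Gamma\{\ \}$. **Rules** (all premises and conclusions are full sequents; otherwise contexts are arbitrary). System $\mathsf{NCK}$: - $\bot^\bullet$: axiom $\Gamma\{\bot^\bullet,\Pi^\circ\}$; $\mathsf{id}$: axiom $\Gamma\{a^\bullet,a^\circ\}$ ($a$ a propositional variable); - $\wedge^\bullet$: from $\Gamma\{A^\bullet,B^\bullet\}$ infer $\Gamma\{(A\wedge B)^\bullet\}$; $\wedge^\circ$: from $\Gamma\{A^\circ\}$ and $\Gamma\{B^\circ\}$ infer $\Gamma\{(A\wedge B)^\circ\}$; - $\vee^\bullet$: from $\Gamma\{A^\bullet,\Pi^\circ\}$ and $\Gamma\{B^\bullet,\Pi^\circ\}$ infer $\Gamma\{(A\vee B)^\bullet,\Pi^\circ\}$; $\vee^\circ$: from $\Gamma\{A^\circ\}$ (or from $\Gamma\{B^\circ\}$) infer $\Gamma\{(A\vee B)^\circ\}$; - $\supset^\bullet$: from $\Gamma^{\Downarrow}\{A^\circ\}$ and $\Gamma\{B^\bullet\}$ infer $\Gamma\{(A\supset B)^\bullet\}$; $\supset^\circ$: from $\Gamma\{A^\bullet,B^\circ\}$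 infer $\Gamma\{(A\supset B)^\circ\}$; - $\Box^\bullet$: from $\Gamma\{[A^\bullet,\Delta]\}$ infer $\Gamma\{(\Box A)^\bullet,[\Delta]\}$; $\Box^\circ$: from $\Gamma\{[A^\circ]\}$ infer $\Gamma\{(\Box A)^\circ\}$; - $\Diamond^\bullet$: from $\Gamma\{[A^\bullet]\}$ infer $\Gamma\{(\Diamond A)^\bullet\}$; $\Diamond^\circ$: from $\Gamma\{[A^\circ,\Delta]\}$ infer $\Gamma\{(\Diamond A)^\circ,[\Delta]\}$; - $\mathsf{c}$ (contraction): from $\Gamma\{\Delta^\bullet,\Delta^\bullet\}$ infer $\Gamma\{\Delta^\bullet\}$. Further rules: $\mathsf{w}$ (weakening): from $\Gamma\{\emptyset\}$ infer $\Gamma\{\Delta^\bullet\}$. $\mathsf{cut}$: from $\Gamma^{\Downarrow}\{A^\circ\}$ and $\Gamma\{A^\bullet\}$ infer $\Gamma\{\emptyset\}$. Logical rules for $\mathsf{d},\mathsf{t},\mathsf{4}$: $\mathsf{d}^\circ$: from $\Gamma\{[A^\circ]\}$ infer $\Gamma\{(\Diamond A)^\circ\}$; $\mathsf{d}^\bullet$: from $\Gamma\{[A^\bullet]\}$ infer $\Gamma\{(\Box A)^\bullet\}$; $\mathsf{t}^\circ$: from $\Gamma\{A^\circ\}$ infer $\Gamma\{(\Diamond A)^\circ\}$; $\mathsf{t}^\bullet$: from $\Gamma\{A^\bullet\}$ infer $\Gamma\{(\Box A)^\bullet\}$; $\mathsf{4}^\circ$: from $\Gamma\{[(\Diamond A)^\circ,\Delta]\}$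 infer $\Gamma\{(\Diamond A)^\circ,[\Delta]\}$; $\mathsf{4}^\bullet$: from $\Gamma\{[(\Box A)^\bullet,\Delta]\}$ infer $\Gamma\{(\Box A)^\bullet,[\Delta]\}$. For $\mathsf{X}\subseteq\{\mathsf d,\mathsf t,\mathsf 4\}$, $\mathsf{X}^{\bullet\circ}=\{\mathsf{x}^\bullet,\mathsf{x}^\circ\mid\mathsf{x}\in\mathsf{X}\}$. Structural rules: $\mathsf{d}^{[\,]}$: from $\Gamma\{[\emptyset]\}$ infer $\Gamma\{\emptyset\}$; $\mathsf{t}^{[\,]}$: from $\Gamma\{[\Sigma]\}$ infer $\Gamma\{\Sigma\}$; $\mathsf{b}^{[\,]}$: from $\Gamma\{[[\Sigma],\Delta]\}$ infer $\Gamma\{\Sigma,[\Delta]\}$; $\mathsf{4}^{[\,]}$: from $\Gamma\{[\Sigma]\}$ infer $\Gamma\{[[\Sigma]]\}$; $\mathsf{5}^{[\,]}$: from $\Gamma\{[[\Sigma],\Delta]\}$ infer $\Gamma\{[\Sigma],[\Delta]\}$. For a set $\mathsf{Y}$ of axiom names, $\mathsf{Y}^{[\,]}=\{\mathsf{y}^{[\,]}\mid\mathsf{y}\in\mathsf{Y}\}$. **Hilbert system.** $\mathsf{HCK}$ is a complete axiomatization of intuitionistic propositional logic extended with the axiom schemes $\mathsf{k}_1:\Box(A\supset B)\supset(\Box A\supset\Box B)$ and $\mathsf{k}_2:\Box(A\supset B)\supset(\Diamond A\supset\Diamond B)$ and the rules modus ponens and necessitation (from $A$ infer $\Box A$). For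 a set $\mathsf{Z}\subseteq\{\mathsf{d},\mathsf{t},\mathsf{b},\mathsf{4},\mathsf{5}\}$, $\mathsf{HCK}+\mathsf{Z}$ adds the corresponding axiom schemes ($\mathsf{HCK}+\mathsf X+\mathsf Y$ means $\mathsf{HCK}+(\mathsf X\cup\mathsf Y)$): $\mathsf{d}:\Box A\supset\Diamond A$; $\mathsf{t}:(A\supset\Diamond A)\wedge(\Box A\supset A)$; $\mathsf{b}:(A\supset\Box\Diamond A)\wedge(\Diamond\Box A\supset A)$; $\mathsf{4}:(\Diamond\Diamond A\supset\Diamond A)\wedge(\Box A\supset\Box\Box A)$; $\mathsf{5}:(\Diamond A\supset\Box\Diamond A)\wedge(\Diamond\Box A\supset\Box A)$. -}

module Defs where

open import Data.List using (List; []; _∷_)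
open import Data.List.Membership.Propositional renaming (_∈_ to _∈ˡ_)
open import Data.List.Relation.Binary.Pointwise using (Pointwise)
open import Data.List.Relation.Unary.All using (All)
open import Data.Nat using (ℕ)
open import Level using (0ℓ)
open import Relation.Unary using (Pred; _∈_)

infix  60 □_ ◇_
infixl 55 _∧_
infixl 54 _∨_
infixr 53 _⊃_
infix  50 _• _°
infixl 40 _,_
infix  30 _≈ˡ_ _≈ʳ_ _≈_
infix  45 _⟨_⟩ˡ _⟨_⟩° _⟨_⟩•

data Formula : Set where
  var         : ℕ → Formula
  ⊥           : Formula
  _∧_ _∨_ _⊃_ : Formula → Formula → Formula
  □_ ◇_       : Formula → Formula

⊤ : Formula
⊤ = ⊥ ⊃ ⊥

-- The conjunction of no formulas is ⊤, that of a single formula is the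
-- formula itself.
⋀ : List Formula → Formula
⋀ []           = ⊤
⋀ (A ∷ [])     = A
⋀ (A ∷ B ∷ As) = A ∧ ⋀ (B ∷ As)

------------------------------------------------------------------------
-- Nested sequents

-- Sequents are kept as syntax trees, since the corresponding formula is
-- defined on trees; that the comma is associative and commutative with
-- unit ∅ is expressed by the equivalences _≈ˡ_, _≈ʳ_ and _≈_ below.
-- The constructors [_] and _,_ are overloaded.

data LHS : Set where
  ∅   : LHS
  _•  : Formula → LHS
  [_] : LHS → LHS
  _,_ : LHS → LHS → LHS

mutual
  data RHS : Set where
    _°  : Formula → RHS
    [_] : Full → RHS

  -- An RHS sequent Ψ on its own is the full sequent ∅ , Ψ.
  data Full : Set where
    _,_ : LHS → RHS → Full

data _≈ˡ_ : LHS → LHS → Set where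
  refl   : ∀ {Φ} → Φ ≈ˡ Φ
  sym    : ∀ {Φ₁ Φ₂} → Φ₁ ≈ˡ Φ₂ → Φ₂ ≈ˡ Φ₁
  trans  : ∀ {Φ₁ Φ₂ Φ₃} → Φ₁ ≈ˡ Φ₂ → Φ₂ ≈ˡ Φ₃ → Φ₁ ≈ˡ Φ₃
  assoc  : ∀ {Φ₁ Φ₂ Φ₃} → Φ₁ , Φ₂ , Φ₃ ≈ˡ Φ₁ , (Φ₂ , Φ₃)
  comm   : ∀ {Φ₁ Φ₂} → Φ₁ , Φ₂ ≈ˡ Φ₂ , Φ₁
  unit   : ∀ {Φ} → ∅ , Φ ≈ˡ Φ
  ,-cong : ∀ {Φ₁ Φ₁′ Φ₂ Φ₂′} → Φ₁ ≈ˡ Φ₁′ → Φ₂ ≈ˡ Φ₂′ → Φ₁ , Φ₂ ≈ˡ Φ₁′ , Φ₂′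
  []-cong : ∀ {Φ Φ′} → Φ ≈ˡ Φ′ → [ Φ ] ≈ˡ [ Φ′ ]

mutual
  data _≈ʳ_ : RHS → RHS → Set where
    °-refl  : ∀ {A} → A ° ≈ʳ A °
    []-cong : ∀ {Σ Σ′} → Σ ≈ Σ′ → [ Σ ] ≈ʳ [ Σ′ ]

  data _≈_ : Full → Full → Set where
    ,-cong : ∀ {Φ Φ′ Ψ Ψ′} → Φ ≈ˡ Φ′ → Ψ ≈ʳ Ψ′ → (Φ , Ψ) ≈ (Φ′ , Ψ′)

fmˡ : LHS → Formula
fmˡ ∅         = ⊤
fmˡ (A •)     = A
fmˡ [ Φ ]     = ◇ fmˡ Φ
fmˡ (Φ₁ , Φ₂) = fmˡ Φ₁ ∧ fmˡ Φ₂

mutual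
  fmʳ : RHS → Formula
  fmʳ (A °)  = A
  fmʳ [ Σ ]  = □ fm Σ

  fm : Full → Formula
  fm (Φ , Ψ) = fmˡ Φ ⊃ fmʳ Ψ

------------------------------------------------------------------------
-- Contexts

-- Γ₁ ,[ Γ₂ ,[ … ,[ Γₙ ,⟨⟩ ] … ] ] is the output context
-- Γ₁,[Γ₂,[…,[Γₙ,{ }]…]].
data OutputContext : Set where
  _,⟨⟩  : LHS → OutputContext
  _,[_] : LHS → OutputContext → OutputContext

_⟨_⟩ˡ : OutputContext → LHS → LHS
(Γ ,⟨⟩)    ⟨ Φ ⟩ˡ = Γ , Φ
(Γ ,[ C ]) ⟨ Φ ⟩ˡ = Γ , [ C ⟨ Φ ⟩ˡ ]

-- The hole of an output context may be filled with any full sequent Φ , Ψ;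
-- filling it with an RHS sequent Ψ is the case ∅ , Ψ.
_⟨_⟩° : OutputContext → Full → Full
(Γ ,⟨⟩)    ⟨ Φ , Ψ ⟩° = Γ , Φ , Ψ
(Γ ,[ C ]) ⟨ Σ ⟩°     = Γ , [ C ⟨ Σ ⟩° ]

_⊙_ : OutputContext → OutputContext → OutputContext
(Γ ,⟨⟩)    ⊙ (Δ ,⟨⟩)    = (Γ , Δ) ,⟨⟩
(Γ ,⟨⟩)    ⊙ (Δ ,[ D ]) = (Γ , Δ) ,[ D ]
(Γ ,[ C ]) ⊙ D          = Γ ,[ C ⊙ D ]

-- outer, inner and output are the Γ′{ }, Λ{ } and Π° of Γ′{Λ{ },Π°}.
record InputContext : Set where
  constructor inputContext
  field
    outer  : OutputContext
    inner  : OutputContext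
    output : RHS

_⟨_⟩• : InputContext → LHS → Full
inputContext Γ′ Λ Π ⟨ Φ ⟩• = Γ′ ⟨ Λ ⟨ Φ ⟩ˡ , Π ⟩°

-- Output pruning. It is the identity on output contexts, so it is only
-- needed for input contexts.
_⇓ : InputContext → OutputContext
inputContext Γ′ Λ Π ⇓ = Γ′ ⊙ Λ

------------------------------------------------------------------------
-- Rules

data Axiom : Set where
  d t b four five : Axiom

data Rule : Set where
  ⊥• id ∧• ∧° ∨• ∨° ⊃• ⊃° □• □° ◇• ◇° c : Rule
  w cut                                 : Rule
  d• d° t• t° 4• 4°                     : Rule
  d[] t[] b[] 4[] 5[]                   : Rule

-- Premises and conclusion of each rule, for chosen representatives of the
-- sequents modulo the laws of the comma. Whether Γ is an input or an output
-- context is forced by the requirement that all sequents be full. Where Δ or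
-- Σ may or may not contain the output formula, each possibility has its own
-- clause; the output then sits in Π, or Δ or Σ is itself a full sequent.
data Scheme : Rule → List Full → Full → Set where
  ⊥•   : ∀ Γ Π → Scheme ⊥• [] (Γ ⟨ ⊥ • , Π ⟩°)
  id   : ∀ Γ a → Scheme id [] (Γ ⟨ var a • , var a ° ⟩°)
  ∧•   : ∀ Γ A B → Scheme ∧• (Γ ⟨ A • , B • ⟩• ∷ []) (Γ ⟨ (A ∧ B) • ⟩•)
  ∧°   : ∀ Γ A B → Scheme ∧° (Γ ⟨ ∅ , A ° ⟩° ∷ Γ ⟨ ∅ , B ° ⟩° ∷ []) (Γ ⟨ ∅ , (A ∧ B) ° ⟩°)
  ∨•   : ∀ Γ A B Π → Scheme ∨• (Γ ⟨ A • , Π ⟩° ∷ Γ ⟨ B • , Π ⟩° ∷ []) (Γ ⟨ (A ∨ B) • , Π ⟩°)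
  ∨°₁  : ∀ Γ A B → Scheme ∨° (Γ ⟨ ∅ , A ° ⟩° ∷ []) (Γ ⟨ ∅ , (A ∨ B) ° ⟩°)
  ∨°₂  : ∀ Γ A B → Scheme ∨° (Γ ⟨ ∅ , B ° ⟩° ∷ []) (Γ ⟨ ∅ , (A ∨ B) ° ⟩°)
  ⊃•   : ∀ Γ A B → Scheme ⊃• ((Γ ⇓) ⟨ ∅ , A ° ⟩° ∷ Γ ⟨ B • ⟩• ∷ []) (Γ ⟨ (A ⊃ B) • ⟩•)
  ⊃°   : ∀ Γ A B → Scheme ⊃° (Γ ⟨ A • , B ° ⟩° ∷ []) (Γ ⟨ ∅ , (A ⊃ B) ° ⟩°)
  □•ˡ  : ∀ Γ A Δ → Scheme □• (Γ ⟨ [ A • , Δ ] ⟩• ∷ []) (Γ ⟨ (□ A) • , [ Δ ] ⟩•)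
  □•ʳ  : ∀ Γ A Δ Π → Scheme □• (Γ ⟨ ∅ , [ A • , Δ , Π ] ⟩° ∷ []) (Γ ⟨ (□ A) • , [ Δ , Π ] ⟩°)
  □°   : ∀ Γ A → Scheme □° (Γ ⟨ ∅ , [ ∅ , A ° ] ⟩° ∷ []) (Γ ⟨ ∅ , (□ A) ° ⟩°)
  ◇•   : ∀ Γ A → Scheme ◇• (Γ ⟨ [ A • ] ⟩• ∷ []) (Γ ⟨ (◇ A) • ⟩•)
  ◇°   : ∀ Γ A Δ → Scheme ◇° (Γ ⟨ ∅ , [ Δ , A ° ] ⟩° ∷ []) (Γ ⟨ [ Δ ] , (◇ A) ° ⟩°)
  c    : ∀ Γ Δ → Scheme c (Γ ⟨ Δ , Δ ⟩• ∷ []) (Γ ⟨ Δ ⟩•)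

  w    : ∀ Γ Δ → Scheme w (Γ ⟨ ∅ ⟩• ∷ []) (Γ ⟨ Δ ⟩•)
  cut  : ∀ Γ A → Scheme cut ((Γ ⇓) ⟨ ∅ , A ° ⟩° ∷ Γ ⟨ A • ⟩• ∷ []) (Γ ⟨ ∅ ⟩•)

  d°   : ∀ Γ A → Scheme d° (Γ ⟨ ∅ , [ ∅ , A ° ] ⟩° ∷ []) (Γ ⟨ ∅ , (◇ A) ° ⟩°)
  d•   : ∀ Γ A → Scheme d• (Γ ⟨ [ A • ] ⟩• ∷ []) (Γ ⟨ (□ A) • ⟩•)
  t°   : ∀ Γ A → Scheme t° (Γ ⟨ ∅ , A ° ⟩° ∷ []) (Γ ⟨ ∅ , (◇ A) ° ⟩°)
  t•   : ∀ Γ A → Scheme t• (Γ ⟨ A • ⟩• ∷ []) (Γ ⟨ (□ A) • ⟩•)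
  4°   : ∀ Γ A Δ → Scheme 4° (Γ ⟨ ∅ , [ Δ , (◇ A) ° ] ⟩° ∷ []) (Γ ⟨ [ Δ ] , (◇ A) ° ⟩°)
  4•ˡ  : ∀ Γ A Δ → Scheme 4• (Γ ⟨ [ (□ A) • , Δ ] ⟩• ∷ []) (Γ ⟨ (□ A) • , [ Δ ] ⟩•)
  4•ʳ  : ∀ Γ A Δ Π → Scheme 4• (Γ ⟨ ∅ , [ (□ A) • , Δ , Π ] ⟩° ∷ []) (Γ ⟨ (□ A) • , [ Δ , Π ] ⟩°)

  d[]  : ∀ Γ → Scheme d[] (Γ ⟨ [ ∅ ] ⟩• ∷ []) (Γ ⟨ ∅ ⟩•)
  t[]ˡ : ∀ Γ Σ → Scheme t[] (Γ ⟨ [ Σ ] ⟩• ∷ []) (Γ ⟨ Σ ⟩•)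
  t[]ʳ : ∀ Γ Σ → Scheme t[] (Γ ⟨ ∅ , [ Σ ] ⟩° ∷ []) (Γ ⟨ Σ ⟩°)
  b[]ˡ : ∀ Γ Σ Δ → Scheme b[] (Γ ⟨ [ [ Σ ] , Δ ] ⟩• ∷ []) (Γ ⟨ Σ , [ Δ ] ⟩•)
  -- output in Δ
  b[]ʳ₁ : ∀ Γ Σ Δ Π → Scheme b[] (Γ ⟨ ∅ , [ [ Σ ] , Δ , Π ] ⟩° ∷ []) (Γ ⟨ Σ , [ Δ , Π ] ⟩°)
  -- output in Σ
  b[]ʳ₂ : ∀ Γ Σ Π Δ → Scheme b[] (Γ ⟨ ∅ , [ Δ , [ Σ , Π ] ] ⟩° ∷ []) (Γ ⟨ Σ , [ Δ ] , Π ⟩°)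
  4[]ˡ : ∀ Γ Σ → Scheme 4[] (Γ ⟨ [ Σ ] ⟩• ∷ []) (Γ ⟨ [ [ Σ ] ] ⟩•)
  4[]ʳ : ∀ Γ Σ → Scheme 4[] (Γ ⟨ ∅ , [ Σ ] ⟩° ∷ []) (Γ ⟨ ∅ , [ ∅ , [ Σ ] ] ⟩°)
  5[]ˡ : ∀ Γ Σ Δ → Scheme 5[] (Γ ⟨ [ [ Σ ] , Δ ] ⟩• ∷ []) (Γ ⟨ [ Σ ] , [ Δ ] ⟩•)
  -- output in Δ
  5[]ʳ₁ : ∀ Γ Σ Δ Π → Scheme 5[] (Γ ⟨ ∅ , [ [ Σ ] , Δ , Π ] ⟩° ∷ []) (Γ ⟨ [ Σ ] , [ Δ , Π ] ⟩°)
  -- output in Σ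
  5[]ʳ₂ : ∀ Γ Σ Δ → Scheme 5[] (Γ ⟨ ∅ , [ Δ , [ Σ ] ] ⟩° ∷ []) (Γ ⟨ [ Δ ] , [ Σ ] ⟩°)

System : Set₁
System = Pred Rule 0ℓ

NCK : System
NCK = _∈ˡ (⊥• ∷ id ∷ ∧• ∷ ∧° ∷ ∨• ∷ ∨° ∷ ⊃• ∷ ⊃° ∷ □• ∷ □° ∷ ◇• ∷ ◇° ∷ c ∷ [])

-- The axioms b and five have no logical rules.
data _•∘ (X : Pred Axiom 0ℓ) : System where
  d• : d ∈ X → (X •∘) d•
  d° : d ∈ X → (X •∘) d°
  t• : t ∈ X → (X •∘) t•
  t° : t ∈ X → (X •∘) t°
  4• : four ∈ X → (X •∘) 4•
  4° : four ∈ X → (X •∘) 4°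

-- X •∘ and Y ⟦⟧ stand for the rule sets written X^{•∘} and Y^{[ ]}.
data _⟦⟧ (Y : Pred Axiom 0ℓ) : System where
  d[] : d ∈ Y → (Y ⟦⟧) d[]
  t[] : t ∈ Y → (Y ⟦⟧) t[]
  b[] : b ∈ Y → (Y ⟦⟧) b[]
  4[] : four ∈ Y → (Y ⟦⟧) 4[]
  5[] : five ∈ Y → (Y ⟦⟧) 5[]

-- Γs / Γ is an instance of a rule in S, for arbitrary representatives of the
-- premises and the conclusion.
data InstanceIn (S : System) (Γs : List Full) (Γ : Full) : Set where
  inst : ∀ {r Γs′ Γ′} → r ∈ S → Pointwise _≈_ Γs Γs′ → Scheme r Γs′ Γ′ → Γ ≈ Γ′ →
         InstanceIn S Γs Γ

data ProvableIn (S : System) : Full → Set where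
  rule : ∀ {Γs Γ} → InstanceIn S Γs Γ → All (ProvableIn S) Γs → ProvableIn S Γ

------------------------------------------------------------------------
-- Hilbert system

axiom : Axiom → Formula → Formula
axiom d    A = □ A ⊃ ◇ A
axiom t    A = (A ⊃ ◇ A) ∧ (□ A ⊃ A)
axiom b    A = (A ⊃ □ ◇ A) ∧ (◇ □ A ⊃ A)
axiom four A = (◇ ◇ A ⊃ ◇ A) ∧ (□ A ⊃ □ □ A)
axiom five A = (◇ A ⊃ □ ◇ A) ∧ (◇ □ A ⊃ □ A)

-- HCK+ Z A: the formula A is provable in HCK extended with the axioms in Z.
data HCK+ (Z : Pred Axiom 0ℓ) : Formula → Set where
  ⊃-k  : ∀ A B → HCK+ Z (A ⊃ B ⊃ A)
  ⊃-s  : ∀ A B C → HCK+ Z ((A ⊃ B ⊃ C) ⊃ (A ⊃ B) ⊃ A ⊃ C)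
  ∧-e₁ : ∀ A B → HCK+ Z (A ∧ B ⊃ A)
  ∧-e₂ : ∀ A B → HCK+ Z (A ∧ B ⊃ B)
  ∧-i  : ∀ A B → HCK+ Z (A ⊃ B ⊃ A ∧ B)
  ∨-i₁ : ∀ A B → HCK+ Z (A ⊃ A ∨ B)
  ∨-i₂ : ∀ A B → HCK+ Z (B ⊃ A ∨ B)
  ∨-e  : ∀ A B C → HCK+ Z ((A ⊃ C) ⊃ (B ⊃ C) ⊃ A ∨ B ⊃ C)
  ⊥-e  : ∀ A → HCK+ Z (⊥ ⊃ A)
  k₁   : ∀ A B → HCK+ Z (□ (A ⊃ B) ⊃ □ A ⊃ □ B)
  k₂   : ∀ A B → HCK+ Z (□ (A ⊃ B) ⊃ ◇ A ⊃ ◇ B)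
  ax   : ∀ {z} → z ∈ Z → ∀ A → HCK+ Z (axiom z A)
  mp   : ∀ {A B} → HCK+ Z (A ⊃ B) → HCK+ Z A → HCK+ Z B
  nec  : ∀ {A} → HCK+ Z A → HCK+ Z (□ A)

{-# OPTIONS --safe #-}
module Submission where

-- Every rule acts at the hole of a context, so it suffices to derive its local
-- form in HCK and to transport it to the root. On the path to the root an
-- output context consists of implications and boxes, which preserve
-- conjunctions (k₁). The inner part of an input context consists of
-- conjunctions and diamonds; it is covariant in the hole, hence the whole
-- input context is contravariant. For the two-premise rules ⊃• and cut, the
-- pruned context provides a boxed copy of the first premise along the path,
-- which k₂ combines with the diamonds.

open import Data.List using (List; []; _∷_; length; map)
open import Data.List.Relation.Binary.Pointwise using (Pointwise; []; _∷_)
open import Data.List.Relation.Unary.All as All using (All; []; _∷_)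
open import Data.Nat using (_≤_)
open import Data.Product as Product using (_×_; proj₁; proj₂)
open import Data.Sum using (inj₁; inj₂)
open import Data.Unit using () renaming (⊤ to Unit)
open import Level using (0ℓ)
open import Relation.Binary.PropositionalEquality using () renaming (refl to ≡-refl)
open import Relation.Unary using (Pred; _∈_; _⊆_; _∪_; ｛_｝)
open import Defs

module Derivations (Z : Pred Axiom 0ℓ) where

  -- Intuitionistic and modal reasoning in the Hilbert system.

  infix  25 _⊢_ _⊣⊢_
  infixr 26 _⨟_
  infixl 27 _·_

  _⊢_ : Formula → Formula → Set
  A ⊢ B = HCK+ Z (A ⊃ B)

  _⊣⊢_ : Formula → Formula → Set
  A ⊣⊢ B = (A ⊢ B) × (B ⊢ A)

  weaken : ∀ {A B} → HCK+ Z B → A ⊢ B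
  weaken = mp (⊃-k _ _)

  _·_ : ∀ {A B C} → A ⊢ B ⊃ C → A ⊢ B → A ⊢ C
  f · g = mp (mp (⊃-s _ _ _) f) g

  ⊢-refl : ∀ {A} → A ⊢ A
  ⊢-refl {A} = ⊃-k A (A ⊃ A) · ⊃-k A A

  _⨟_ : ∀ {A B C} → A ⊢ B → B ⊢ C → A ⊢ C
  f ⨟ g = weaken g · f

  π₁ : ∀ {A B} → A ∧ B ⊢ A
  π₁ = ∧-e₁ _ _

  π₂ : ∀ {A B} → A ∧ B ⊢ B
  π₂ = ∧-e₂ _ _

  ⟨_∣_⟩ : ∀ {A B C} → A ⊢ B → A ⊢ C → A ⊢ B ∧ C
  ⟨ f ∣ g ⟩ = (f ⨟ ∧-i _ _) · g

  ∧-mono : ∀ {A A′ B B′} → A ⊢ A′ → B ⊢ B′ → A ∧ B ⊢ A′ ∧ B′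
  ∧-mono f g = ⟨ π₁ ⨟ f ∣ π₂ ⨟ g ⟩

  ∧-swap : ∀ {A B} → A ∧ B ⊢ B ∧ A
  ∧-swap = ⟨ π₂ ∣ π₁ ⟩

  ∧-assoc : ∀ {A B C} → (A ∧ B) ∧ C ⊣⊢ A ∧ (B ∧ C)
  ∧-assoc = Product._,_ ⟨ π₁ ⨟ π₁ ∣ ∧-mono π₂ ⊢-refl ⟩ ⟨ ∧-mono ⊢-refl π₁ ∣ π₂ ⨟ π₂ ⟩

  -- Takes the place of the deduction theorem: hypotheses are collected in a conjunction to the left
  -- of `⊢` and discharged from there.
  curry : ∀ {A B C} → A ∧ B ⊢ C → A ⊢ B ⊃ C
  curry f = ∧-i _ _ ⨟ mp (⊃-s _ _ _) (weaken f)

  uncurry : ∀ {A B C} → A ⊢ B ⊃ C → A ∧ B ⊢ C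
  uncurry f = (π₁ ⨟ f) · π₂

  ⊃-curry : ∀ {A B C} → A ∧ B ⊃ C ⊢ A ⊃ B ⊃ C
  ⊃-curry = curry (curry (proj₁ ∧-assoc ⨟ uncurry ⊢-refl))

  ⊃-uncurry : ∀ {A B C} → A ⊃ B ⊃ C ⊢ A ∧ B ⊃ C
  ⊃-uncurry = curry (proj₂ ∧-assoc ⨟ uncurry (uncurry ⊢-refl))

  ⊃-mono : ∀ {A A′ B B′} → A′ ⊢ A → B ⊢ B′ → A ⊃ B ⊢ A′ ⊃ B′
  ⊃-mono f g = curry (∧-mono ⊢-refl f ⨟ uncurry ⊢-refl ⨟ g)

  ⊃-monoˡ : ∀ {A A′ B} → A′ ⊢ A → A ⊃ B ⊢ A′ ⊃ B
  ⊃-monoˡ f = ⊃-mono f ⊢-refl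

  ⊃-monoʳ : ∀ {A B B′} → B ⊢ B′ → A ⊃ B ⊢ A ⊃ B′
  ⊃-monoʳ = ⊃-mono ⊢-refl

  ⊃-mono₂ : ∀ {A B₁ B₂ B} → B₁ ∧ B₂ ⊢ B → (A ⊃ B₁) ∧ (A ⊃ B₂) ⊢ A ⊃ B
  ⊃-mono₂ f = curry (⟨ uncurry π₁ ∣ uncurry π₂ ⟩ ⨟ f)

  ⊤-intro : ∀ {A} → A ⊢ ⊤
  ⊤-intro = weaken ⊢-refl

  ⊤⊃-elim : ∀ {A} → ⊤ ⊃ A ⊢ A
  ⊤⊃-elim = ⊢-refl · ⊤-intro

  □-mono : ∀ {A B} → A ⊢ B → □ A ⊢ □ B
  □-mono f = mp (k₁ _ _) (nec f)

  ◇-mono : ∀ {A B} → A ⊢ B → ◇ A ⊢ ◇ B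
  ◇-mono f = mp (k₂ _ _) (nec f)

  □-mono₂ : ∀ {A B C} → A ∧ B ⊢ C → □ A ∧ □ B ⊢ □ C
  □-mono₂ f = uncurry (□-mono (curry f) ⨟ k₁ _ _)

  -- By `k₂` a boxed formula may enter a diamond; two diamonds could not be merged in this way.
  ◇-mono₂ : ∀ {A B C} → A ∧ B ⊢ C → □ A ∧ ◇ B ⊢ ◇ C
  ◇-mono₂ f = uncurry (□-mono (curry f) ⨟ k₂ _ _)

  -- Invariance under the laws of the comma.

  ≈ˡ-sound : ∀ {Φ Φ′} → Φ ≈ˡ Φ′ → fmˡ Φ ⊣⊢ fmˡ Φ′
  ≈ˡ-sound refl         = Product._,_ ⊢-refl ⊢-refl
  ≈ˡ-sound (sym p)      = Product.swap (≈ˡ-sound p)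
  ≈ˡ-sound (trans p q)  = Product.zip _⨟_ (λ f g → g ⨟ f) (≈ˡ-sound p) (≈ˡ-sound q)
  ≈ˡ-sound assoc        = ∧-assoc
  ≈ˡ-sound comm         = Product._,_ ∧-swap ∧-swap
  ≈ˡ-sound unit         = Product._,_ π₂ ⟨ ⊤-intro ∣ ⊢-refl ⟩
  ≈ˡ-sound (,-cong p q) = Product.zip ∧-mono ∧-mono (≈ˡ-sound p) (≈ˡ-sound q)
  ≈ˡ-sound ([]-cong p)  = Product.map ◇-mono ◇-mono (≈ˡ-sound p)

  mutual
    ≈ʳ-sound : ∀ {Ψ Ψ′} → Ψ ≈ʳ Ψ′ → fmʳ Ψ ⊣⊢ fmʳ Ψ′
    ≈ʳ-sound °-refl      = Product._,_ ⊢-refl ⊢-refl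
    ≈ʳ-sound ([]-cong p) = Product.map □-mono □-mono (≈-sound p)

    ≈-sound : ∀ {Σ Σ′} → Σ ≈ Σ′ → fm Σ ⊣⊢ fm Σ′
    ≈-sound (,-cong p q) =
      Product.zip ⊃-mono ⊃-mono (Product.swap (≈ˡ-sound p)) (≈ʳ-sound q)

  ⋀-mono : ∀ {Γs Γs′} → Pointwise _≈_ Γs Γs′ → ⋀ (map fm Γs) ⊢ ⋀ (map fm Γs′)
  ⋀-mono []               = ⊢-refl
  ⋀-mono (p ∷ [])         = proj₁ (≈-sound p)
  ⋀-mono (p ∷ ps@(_ ∷ _)) = ∧-mono (proj₁ (≈-sound p)) (⋀-mono ps)

  -- Transport of derivations through contexts.

  ⟨⟩°-valid : ∀ C {Σ} → HCK+ Z (fm Σ) → HCK+ Z (fm (C ⟨ Σ ⟩°))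
  ⟨⟩°-valid (Γ ,⟨⟩) {_ , _} p = mp ⊃-uncurry (weaken p)
  ⟨⟩°-valid (Γ ,[ C ])      p = weaken (nec (⟨⟩°-valid C p))

  ⟨⟩°-mono₂ : ∀ C {Σ₁ Σ₂ Σ} → fm Σ₁ ∧ fm Σ₂ ⊢ fm Σ →
              fm (C ⟨ Σ₁ ⟩°) ∧ fm (C ⟨ Σ₂ ⟩°) ⊢ fm (C ⟨ Σ ⟩°)
  ⟨⟩°-mono₂ (Γ ,⟨⟩) {_ , _} {_ , _} {_ , _} f =
    ∧-mono ⊃-curry ⊃-curry ⨟ ⊃-mono₂ f ⨟ ⊃-uncurry
  ⟨⟩°-mono₂ (Γ ,[ C ]) f = ⊃-mono₂ (□-mono₂ (⟨⟩°-mono₂ C f))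

  ⟨⟩°-mono : ∀ C {Σ Σ′} → fm Σ ⊢ fm Σ′ → fm (C ⟨ Σ ⟩°) ⊢ fm (C ⟨ Σ′ ⟩°)
  ⟨⟩°-mono C f = ⟨ ⊢-refl ∣ ⊢-refl ⟩ ⨟ ⟨⟩°-mono₂ C (π₁ ⨟ f)

  ⟨⟩ˡ-mono : ∀ C {Φ Φ′} → fmˡ Φ ⊢ fmˡ Φ′ → fmˡ (C ⟨ Φ ⟩ˡ) ⊢ fmˡ (C ⟨ Φ′ ⟩ˡ)
  ⟨⟩ˡ-mono (Γ ,⟨⟩)    f = ∧-mono ⊢-refl f
  ⟨⟩ˡ-mono (Γ ,[ C ]) f = ∧-mono ⊢-refl (◇-mono (⟨⟩ˡ-mono C f))

  ⟨⟩•-anti : ∀ Γ {Φ Φ′} → fmˡ Φ′ ⊢ fmˡ Φ → fm (Γ ⟨ Φ ⟩•) ⊢ fm (Γ ⟨ Φ′ ⟩•)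
  ⟨⟩•-anti (inputContext Γ′ Λ Π) f = ⟨⟩°-mono Γ′ (⊃-monoˡ (⟨⟩ˡ-mono Λ f))

  -- The two formulas differ at most in the bracketing of one conjunction, and only when `D` has its
  -- hole at top level.
  ⊙-sound : ∀ C D {Σ} → fm ((C ⊙ D) ⟨ Σ ⟩°) ⊢ fm (C ⟨ D ⟨ Σ ⟩° ⟩°)
  ⊙-sound (Γ ,⟨⟩)    (Δ ,⟨⟩) {_ , _} = ⊃-monoˡ (proj₂ ∧-assoc)
  ⊙-sound (Γ ,⟨⟩)    (Δ ,[ D ])      = ⊢-refl
  ⊙-sound (Γ ,[ C ]) D               = ⊃-monoʳ (□-mono (⊙-sound C D))

  -- Both contexts are descended in parallel: at each level the conjunct for `Γ` discharges the
  -- implication and is kept for the conclusion, and the box so released is combined with the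
  -- diamond by `◇-mono₂`.
  ⟨⟩ˡ-detach : ∀ C {A Φ Φ′} → A ∧ fmˡ Φ ⊢ fmˡ Φ′ →
               fm (C ⟨ ∅ , A ° ⟩°) ∧ fmˡ (C ⟨ Φ ⟩ˡ) ⊢ fmˡ (C ⟨ Φ′ ⟩ˡ)
  ⟨⟩ˡ-detach (Γ ,⟨⟩) f =
    -- `⊤-intro` supplies the conjunct coming from the `∅` in `∅ , A °`.
    ⟨ π₂ ⨟ π₁ ∣ ⟨ π₁ · ⟨ π₂ ⨟ π₁ ∣ ⊤-intro ⟩ ∣ π₂ ⨟ π₂ ⟩ ⨟ f ⟩
  ⟨⟩ˡ-detach (Γ ,[ C ]) f =
    ⟨ π₂ ⨟ π₁ ∣ ⟨ π₁ · (π₂ ⨟ π₁) ∣ π₂ ⨟ π₂ ⟩ ⨟ ◇-mono₂ (⟨⟩ˡ-detach C f) ⟩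

  -- Common form of `⊃•`, where `Φ` is `B •` and `Φ′` is `(A ⊃ B) •`, and of `cut`, where they are
  -- `A •` and `∅`.
  ⟨⟩•-detach : ∀ Γ {A Φ Φ′} → A ∧ fmˡ Φ′ ⊢ fmˡ Φ →
               fm ((Γ ⇓) ⟨ ∅ , A ° ⟩°) ∧ fm (Γ ⟨ Φ ⟩•) ⊢ fm (Γ ⟨ Φ′ ⟩•)
  ⟨⟩•-detach (inputContext Γ′ Λ Π) f =
    ∧-mono (⊙-sound Γ′ Λ) ⊢-refl ⨟
    -- Under `Γ′`, the first premise turns `Λ ⟨ Φ′ ⟩ˡ` into `Λ ⟨ Φ ⟩ˡ`, from which the second
    -- premise yields `Π`.
    ⟨⟩°-mono₂ Γ′ (curry ((π₁ ⨟ π₂) · (∧-mono π₁ ⊢-refl ⨟ ⟨⟩ˡ-detach Λ f)))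

  -- Soundness of the individual rules.

  Justified : Rule → Set
  Justified d•  = d ∈ Z
  Justified d°  = d ∈ Z
  Justified t•  = t ∈ Z
  Justified t°  = t ∈ Z
  Justified 4•  = four ∈ Z
  Justified 4°  = four ∈ Z
  Justified d[] = d ∈ Z
  Justified t[] = t ∈ Z
  Justified b[] = b ∈ Z
  Justified 4[] = four ∈ Z
  Justified 5[] = five ∈ Z
  Justified _   = Unit

  t◇ : t ∈ Z → ∀ {A} → A ⊢ ◇ A
  t◇ z = mp π₁ (ax z _)

  t□ : t ∈ Z → ∀ {A} → □ A ⊢ A
  t□ z = mp π₂ (ax z _)

  b□◇ : b ∈ Z → ∀ {A} → A ⊢ □ ◇ A
  b□◇ z = mp π₁ (ax z _)

  b◇□ : b ∈ Z → ∀ {A} → ◇ □ A ⊢ A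
  b◇□ z = mp π₂ (ax z _)

  4◇ : four ∈ Z → ∀ {A} → ◇ ◇ A ⊢ ◇ A
  4◇ z = mp π₁ (ax z _)

  4□ : four ∈ Z → ∀ {A} → □ A ⊢ □ □ A
  4□ z = mp π₂ (ax z _)

  5□◇ : five ∈ Z → ∀ {A} → ◇ A ⊢ □ ◇ A
  5□◇ z = mp π₁ (ax z _)

  5◇□ : five ∈ Z → ∀ {A} → ◇ □ A ⊢ □ A
  5◇□ z = mp π₂ (ax z _)

  -- Serves the rules that move an input out of a bracket containing the output; `⊤` stands for the
  -- `∅` beside that bracket in the premise.
  ⊤⊃□-distrib : ∀ {A B C} → ⊤ ⊃ □ (A ∧ B ⊃ C) ⊢ □ A ⊃ □ (B ⊃ C)
  ⊤⊃□-distrib = ⊤⊃-elim ⨟ □-mono ⊃-curry ⨟ k₁ _ _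

  -- Serves the rules that move the output out of a bracket, which thereby becomes an input and
  -- changes from a box to a diamond.
  ⊤⊃□-◇ : ∀ {A B} → ⊤ ⊃ □ (A ⊃ B) ⊢ ◇ A ⊃ ◇ B
  ⊤⊃□-◇ = ⊤⊃-elim ⨟ k₂ _ _

  scheme-sound : ∀ {r Γs Γ} → Scheme r Γs Γ → Justified r → ⋀ (map fm Γs) ⊢ fm Γ
  scheme-sound (⊥• Γ Π)        _ = weaken (⟨⟩°-valid Γ (⊥-e _))
  scheme-sound (id Γ a)        _ = weaken (⟨⟩°-valid Γ ⊢-refl)
  scheme-sound (∧• Γ A B)      _ = ⟨⟩•-anti Γ ⊢-refl
  scheme-sound (∧° Γ A B)      _ = ⟨⟩°-mono₂ Γ (⊃-mono₂ ⊢-refl)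
  scheme-sound (∨• Γ A B Π)    _ = ⟨⟩°-mono₂ Γ (uncurry (∨-e _ _ _))
  scheme-sound (∨°₁ Γ A B)     _ = ⟨⟩°-mono Γ (⊃-monoʳ (∨-i₁ _ _))
  scheme-sound (∨°₂ Γ A B)     _ = ⟨⟩°-mono Γ (⊃-monoʳ (∨-i₂ _ _))
  scheme-sound (⊃• Γ A B)      _ = ⟨⟩•-detach Γ (π₂ · π₁)
  scheme-sound (⊃° Γ A B)      _ = ⟨⟩°-mono Γ (⊃-k _ _)
  scheme-sound (□•ˡ Γ A Δ)     _ = ⟨⟩•-anti Γ (◇-mono₂ ⊢-refl)
  scheme-sound (□•ʳ Γ A Δ Π)   _ = ⟨⟩°-mono Γ ⊤⊃□-distrib
  scheme-sound (□° Γ A)        _ = ⟨⟩°-mono Γ (⊃-monoʳ (□-mono ⊤⊃-elim))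
  scheme-sound (◇• Γ A)        _ = ⟨⟩•-anti Γ ⊢-refl
  scheme-sound (◇° Γ A Δ)      _ = ⟨⟩°-mono Γ ⊤⊃□-◇
  scheme-sound (c Γ Δ)         _ = ⟨⟩•-anti Γ ⟨ ⊢-refl ∣ ⊢-refl ⟩
  scheme-sound (w Γ Δ)         _ = ⟨⟩•-anti Γ ⊤-intro
  scheme-sound (cut Γ A)       _ = ⟨⟩•-detach Γ π₁
  scheme-sound (d° Γ A)        z = ⟨⟩°-mono Γ (⊃-monoʳ (□-mono ⊤⊃-elim ⨟ ax z _))
  scheme-sound (d• Γ A)        z = ⟨⟩•-anti Γ (ax z _)
  scheme-sound (t° Γ A)        z = ⟨⟩°-mono Γ (⊃-monoʳ (t◇ z))
  scheme-sound (t• Γ A)        z = ⟨⟩•-anti Γ (t□ z)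
  scheme-sound (4° Γ A Δ)      z = ⟨⟩°-mono Γ (⊤⊃□-◇ ⨟ ⊃-monoʳ (4◇ z))
  scheme-sound (4•ˡ Γ A Δ)     z = ⟨⟩•-anti Γ (∧-mono (4□ z) ⊢-refl ⨟ ◇-mono₂ ⊢-refl)
  scheme-sound (4•ʳ Γ A Δ Π)   z = ⟨⟩°-mono Γ (⊤⊃□-distrib ⨟ ⊃-monoˡ (4□ z))
  -- Axiom `d` at `⊤` proves `◇ ⊤`, the formula of `[ ∅ ]`, from the necessitated `□ ⊤`.
  scheme-sound (d[] Γ)         z = ⟨⟩•-anti Γ (weaken (mp (ax z _) (nec ⊢-refl)))
  scheme-sound (t[]ˡ Γ Σ)      z = ⟨⟩•-anti Γ (t◇ z)
  scheme-sound (t[]ʳ Γ Σ)      z = ⟨⟩°-mono Γ (⊤⊃-elim ⨟ t□ z)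
  scheme-sound (b[]ˡ Γ Σ Δ)    z = ⟨⟩•-anti Γ (∧-mono (b□◇ z) ⊢-refl ⨟ ◇-mono₂ ⊢-refl)
  scheme-sound (b[]ʳ₁ Γ Σ Δ Π) z = ⟨⟩°-mono Γ (⊤⊃□-distrib ⨟ ⊃-monoˡ (b□◇ z))
  scheme-sound (b[]ʳ₂ Γ Σ Π Δ) z =
    -- The inner bracket is a box that `k₂` puts under a diamond, where `b` removes both; the rest
    -- only reorders the antecedents.
    ⟨⟩°-mono Γ (⊤⊃□-◇ ⨟ ⊃-monoʳ (b◇□ z) ⨟ ⊃-uncurry ⨟ ⊃-monoˡ ∧-swap)
  scheme-sound (4[]ˡ Γ Σ)      z = ⟨⟩•-anti Γ (4◇ z)
  scheme-sound (4[]ʳ Γ Σ)      z = ⟨⟩°-mono Γ (⊃-monoʳ (4□ z ⨟ □-mono (⊃-k _ _)))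
  scheme-sound (5[]ˡ Γ Σ Δ)    z = ⟨⟩•-anti Γ (∧-mono (5□◇ z) ⊢-refl ⨟ ◇-mono₂ ⊢-refl)
  scheme-sound (5[]ʳ₁ Γ Σ Δ Π) z = ⟨⟩°-mono Γ (⊤⊃□-distrib ⨟ ⊃-monoˡ (5□◇ z))
  scheme-sound (5[]ʳ₂ Γ Σ Δ)   z = ⟨⟩°-mono Γ (⊤⊃□-◇ ⨟ ⊃-monoʳ (5◇□ z))

  -- Soundness of rule instances and of whole derivations.

  module _ {S : System} (justified : ∀ {r} → r ∈ S → Justified r) where

    instance-sound : ∀ {Γs Γ} → InstanceIn S Γs Γ → ⋀ (map fm Γs) ⊢ fm Γ
    instance-sound (inst r∈S ps s p) =
      ⋀-mono ps ⨟ scheme-sound s (justified r∈S) ⨟ proj₂ (≈-sound p)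

    mutual
      provable-sound : ∀ {Γ} → ProvableIn S Γ → HCK+ Z (fm Γ)
      provable-sound (rule i ps) = mp (instance-sound i) (⋀-sound ps)

      ⋀-sound : ∀ {Γs} → All (ProvableIn S) Γs → HCK+ Z (⋀ (map fm Γs))
      ⋀-sound []               = ⊢-refl
      ⋀-sound (p ∷ [])         = provable-sound p
      ⋀-sound (p ∷ ps@(_ ∷ _)) = mp (mp (∧-i _ _) (provable-sound p)) (⋀-sound ps)

module _ (X Y : Pred Axiom 0ℓ) where
  open Derivations (X ∪ Y)

  NCK-justified : All Justified
    (⊥• ∷ id ∷ ∧• ∷ ∧° ∷ ∨• ∷ ∨° ∷ ⊃• ∷ ⊃° ∷ □• ∷ □° ∷ ◇• ∷ ◇° ∷ c ∷ [])
  NCK-justified = _ ∷ _ ∷ _ ∷ _ ∷ _ ∷ _ ∷ _ ∷ _ ∷ _ ∷ _ ∷ _ ∷ _ ∷ _ ∷ []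

  -- Logical rules draw their axiom from the `X` side of the union and structural rules from the `Y`
  -- side.
  justified : ∀ {r} → r ∈ NCK ∪ ｛ w ｝ ∪ ｛ cut ｝ ∪ (X •∘) ∪ (Y ⟦⟧) → Justified r
  justified (inj₁ r∈NCK)                           = All.lookup NCK-justified r∈NCK
  justified (inj₂ (inj₁ ≡-refl))                   = _
  justified (inj₂ (inj₂ (inj₁ ≡-refl)))            = _
  justified (inj₂ (inj₂ (inj₂ (inj₁ (d• z)))))     = inj₁ z
  justified (inj₂ (inj₂ (inj₂ (inj₁ (d° z)))))     = inj₁ z
  justified (inj₂ (inj₂ (inj₂ (inj₁ (t• z)))))     = inj₁ z
  justified (inj₂ (inj₂ (inj₂ (inj₁ (t° z)))))     = inj₁ z
  justified (inj₂ (inj₂ (inj₂ (inj₁ (4• z)))))     = inj₁ z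
  justified (inj₂ (inj₂ (inj₂ (inj₁ (4° z)))))     = inj₁ z
  justified (inj₂ (inj₂ (inj₂ (inj₂ (d[] z)))))    = inj₂ z
  justified (inj₂ (inj₂ (inj₂ (inj₂ (t[] z)))))    = inj₂ z
  justified (inj₂ (inj₂ (inj₂ (inj₂ (b[] z)))))    = inj₂ z
  justified (inj₂ (inj₂ (inj₂ (inj₂ (4[] z)))))    = inj₂ z
  justified (inj₂ (inj₂ (inj₂ (inj₂ (5[] z)))))    = inj₂ z

theorem4p1 : (X Y : Pred Axiom 0ℓ) →
    X ⊆ ｛ d ｝ ∪ ｛ t ｝ ∪ ｛ four ｝ →
    ((Γs : List Full) (Γ : Full) →
    length Γs ≤ 2 →
    InstanceIn (NCK ∪ ｛ w ｝ ∪ ｛ cut ｝ ∪ (X •∘) ∪ (Y ⟦⟧)) Γs Γ →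
    HCK+ (X ∪ Y) (⋀ (map fm Γs) ⊃ fm Γ))
    ×
    ((Γ : Full) →
    ProvableIn (NCK ∪ ｛ w ｝ ∪ ｛ cut ｝ ∪ (X •∘) ∪ (Y ⟦⟧)) Γ →
    HCK+ (X ∪ Y) (fm Γ))
theorem4p1 X Y _ = Product._,_
  (λ _ _ _ i → instance-sound (justified X Y) i)
  (λ _ p → provable-sound (justified X Y) p)
  where open Derivations (X ∪ Y)
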